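{- Let $k\ge 1$, $\ell\ge 0$, $i\in[1,k]$, let $\varphi(x_1,\dots,x_k,X_1,\dots,X_\ell)$ be a formula, and let ${\cal A}=(\Sigma,Q,\Delta,Q_0,F)$, with $\Sigma=\{0,1\}^{k+\ell}$, be an infinite-word (Büchi) automaton accepting the language $L_\varphi$ of encodings of all models of $\varphi$. Let ${\cal A}''$ be the infinite-word automaton over $\Sigma'=\{0,1\}^{k+\ell-1}$ constructed from ${\cal A}$ and $i$ as described in the context. If an ultimately periodic word $w''$ over $\Sigma'$ is such that for every $n\ge 0$ there exists an accepting run $\rho_n$ of ${\cal A}$, starting from an initial state, such that (1) the word $w_n$ read by $\rho_n$ satisfies $\Pi_{\neq i}(w_n)=w''$, and (2) the $(n+1)$-th transition with a non-empty label followed by $\rho_n$ is associated to the quantified variable $x_i$, i.e., the $i$-th component of its label equals $1$, then $w''\in L({\cal A}'')$.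
   Context: **Formulas and encodings.** Formulas are interpreted in a structure $(\mathbb N,R_1,R_2,\dots)$, each $R_j\subseteq\mathbb N^{\alpha_j}$ with $\alpha_j>0$. They are built from the atoms $\top$, $\bot$, $x_a=x_b$, $X_a=X_b$, $X_a(x_b)$, $R_a(x_{b_1},\dots,x_{b_{\alpha_a}})$ using $\wedge,\vee,\neg$ and the first-order quantifiers $\exists x_a,\forall x_a$. First-order variables $x_a$ range over $\mathbb N$ and second-order variables $X_a$ (never quantified) over subsets of $\mathbb N$; the semantics is the usual one. An interpretation $I$ assigns values to the free variables; a model of $\varphi$ is an interpretation making $\varphi$ true. The encoding $e(I)$ of an interpretation of $x_1,\dots,x_k,X_1,\dots,X_\ell$ is the infinite word over $\{0,1\}^{k+\ell}$ whose $a$-th component, $a\le k$, is $0^{I(x_a)}10^\omega$, and whose $(k+b)$-th component, $b\le \ell$, is the characteristic sequence of $I(X_b)$. $L_\varphi=\{e(I)\mid I\models\varphi\}$. **Automata.** An automaton is a tuple $(\Sigma,Q,\Delta,Q_0,F)$ with $\Sigma$ a finite alphabet, $Q$ a finite set of states, $\Delta\subseteq Q\times(\Sigma\cup\{\varepsilon\})\times Q$, initial states $Q_0\subseteq Q$ and accepting states $F\subseteq Q$. A transition labeled $\varepsilon$ has an empty label. A path from $q$ to $r$ is a finite (possibly empty) sequence of consecutive transitions, and reads the finite word obtained by concatenating its labels; $L({\cal A},q,r)$ is the set of finite words read by paths from $q$ to $r$. For an infinite-word automaton, a run is an infinite sequence of consecutive transitions whose concatenated labels form an infinite word; it is accepting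 iff it visits some state of $F$ infinitely often (Büchi condition). $L({\cal A})$ is the set of infinite words read by accepting runs starting in $Q_0$. A finite-word automaton accepts the finite words read by paths from an initial to an accepting state. An infinite word is ultimately periodic if it is of the form $u\cdot v^\omega$ with $u$ a finite word and $v$ a non-empty finite word. **Projection.** $\Pi_{\neq i}$ deletes the $i$-th component of each tuple symbol of a (finite or infinite) word over $\{0,1\}^{k+\ell}$; it is extended to languages elementwise. **The automaton ${\cal A}'$.** ${\cal A}'=(\Sigma',Q',\Delta',Q'_0,F')$ with $\Sigma'=\Pi_{\neq i}(\Sigma)$, $Q'=2^Q\setminus\{\emptyset\}$, $Q'_0=2^{Q_0}\setminus\{\emptyset\}$, $F'=Q'$ (provisionally), and $\Delta'$ consists of: - the transitions $(q'_1,a',q'_2)$, $a'\in\Sigma'$, for which there is a set $T\subseteq\Delta$ of transitions with labels in $\Sigma$ such that $q'_1=\{q_1\mid (q_1,a,q_2)\in T\}$, $q'_2=\{q_2\mid (q_1,a,q_2)\in T\}$, every $(q_1,a,q_2)\in T$ satisfies $\Pi_{\neq i}(a)=a'$, and exactly one $(q_1,a,q_2)\in T$ has $i$-th component of $a$ equal to $1$; - the transitions $(q'_1,\varepsilon,q'_2)$ for which there is $(q_1,\varepsilon,q_2)\in\Delta$ with $q_1\in q'_1$ and either $q'_2=q'_1\cup\{q_2\}$ or $q'_2=(q'_1\setminus\{q_1\})\cup\{q_2\}$. **The automaton ${\cal A}''$.** It is obtained as follows. 1. For each $q\in Q$, let ${\cal A}_q$ be a finite-word automaton accepting the non-empty words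 $u$ such that there is a path of ${\cal A}$ from $q$ to $q$ that visits at least one state of $F$ and reads a word $v$ with $\Pi_{\neq i}(v)=u$. 2. For $q_1,q_2\in Q$, let ${\cal A}_{q_1,q_2}$ be a finite-word automaton accepting $\Pi_{\neq i}(L({\cal A},q_1,q_2))$. 3. For $q\in Q$, let $U_q=\bigcup_{r\in Q}\bigl(L({\cal A}_{q,r})\cap L({\cal A}_r)\bigr)$. 4. For each $q'\in Q'$ with $q'\cap F\ne\emptyset$, let $U'_{q'}=L({\cal A}',q',q')\cap\bigcap_{q\in q'}U_q$, and let ${\cal A}'_{U'_{q'}}$ be a finite-word automaton accepting $U'_{q'}$. 5. For each such $q'$, build an infinite-word automaton ${\cal A}'_{(U'_{q'})^\omega}$ (the widget of $q'$) accepting $(U'_{q'})^\omega$: add to ${\cal A}'_{U'_{q'}}$ a new state $q'_{\mathit{repeat}}$, transitions $(q'_{\mathit{repeat}},\varepsilon,q_0)$ for each initial state $q_0$ and $(q_F,\varepsilon,q'_{\mathit{repeat}})$ for each accepting state $q_F$ of ${\cal A}'_{U'_{q'}}$, and make $q'_{\mathit{repeat}}$ the only initial and accepting state. 6. ${\cal A}''$ is obtained from ${\cal A}'$ by adding, for each $q'$ with $q'\cap F\neq\emptyset$, the states and transitions of (a disjoint copy of) the widget of $q'$ and the transition $(q',\varepsilon,q'_{\mathit{repeat}})$. Its initial states are $Q'_0$, and its only accepting states are the states $q'_{\mathit{repeat}}$ of all widgets. -}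

module Defs where

open import Data.Bool using (Bool; true; false)
open import Data.Empty using (⊥)
open import Data.Fin using (Fin; _↑ˡ_)
open import Data.Fin.Subset as Subset using (Subset; Nonempty; ⁅_⁆)
open import Data.List as List using (List; []; _∷_)
open import Data.List.NonEmpty as List⁺ using (List⁺)
open import Data.Maybe using (Maybe; just; nothing)
open import Data.Nat using (ℕ; zero; suc; _+_; _≤_; _≡ᵇ_; NonZero)
open import Data.Nat.DivMod using (_mod_)
open import Data.Product using (Σ-syntax; ∃; ∃-syntax; ∃!; _×_; _,_; proj₁; proj₂)
open import Data.Refinement using (Refinement; Refinement-syntax; value)
open import Data.Sum using (_⊎_)
open import Data.Unit using (⊤)
open import Data.Vec as Vec using (Vec; lookup; removeAt)
open import Function using (_∘_)
open import Function.Bundles using (_⇔_; _↔_; Inverse)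
open import Level using (0ℓ)
open import Relation.Binary.PropositionalEquality using (_≡_; _≢_; _≗_)
open import Relation.Nullary using (¬_)
open import Relation.Unary using (Pred; Decidable; _≐_; _∩_; ⋃)

------------------------------------------------------------------------
-- Formulas

record Structure : Set₁ where
  field
    arity         : ℕ → ℕ
    arity-nonZero : ∀ j → NonZero (arity j)
    rel           : ∀ j → Pred (Vec ℕ (arity j)) 0ℓ

-- Formula 𝔐 k ℓ: the free first-order variables are among k variables and
-- the second-order ones among ℓ. First-order variables are de Bruijn
-- indices; a quantifier binds index zero.
data Formula (𝔐 : Structure) (k ℓ : ℕ) : Set where
  ⊤′ ⊥′       : Formula 𝔐 k ℓ
  _≈₁_        : Fin k → Fin k → Formula 𝔐 k ℓ
  _≈₂_        : Fin ℓ → Fin ℓ → Formula 𝔐 k ℓ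
  _⟨_⟩        : Fin ℓ → Fin k → Formula 𝔐 k ℓ
  R           : (j : ℕ) → Vec (Fin k) (Structure.arity 𝔐 j) → Formula 𝔐 k ℓ
  _∧′_ _∨′_   : Formula 𝔐 k ℓ → Formula 𝔐 k ℓ → Formula 𝔐 k ℓ
  ¬′_         : Formula 𝔐 k ℓ → Formula 𝔐 k ℓ
  ∃′_ ∀′_     : Formula 𝔐 (suc k) ℓ → Formula 𝔐 k ℓ

-- Subsets of ℕ are given by their characteristic sequences, which is what
-- the encoding of an interpretation records.
record Interpretation (k ℓ : ℕ) : Set where
  constructor ⟪_,_⟫
  field
    fo : Vec ℕ k
    so : Vec (ℕ → Bool) ℓ

open Interpretation

_,_⊨_ : ∀ {k ℓ : ℕ} (𝔐 : Structure) → Interpretation k ℓ → Formula 𝔐 k ℓ → Set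
𝔐 , I ⊨ ⊤′       = ⊤
𝔐 , I ⊨ ⊥′       = ⊥
𝔐 , I ⊨ (a ≈₁ b) = lookup (fo I) a ≡ lookup (fo I) b
𝔐 , I ⊨ (a ≈₂ b) = lookup (so I) a ≗ lookup (so I) b
𝔐 , I ⊨ (a ⟨ b ⟩) = lookup (so I) a (lookup (fo I) b) ≡ true
𝔐 , I ⊨ R j xs   = Structure.rel 𝔐 j (Vec.map (lookup (fo I)) xs)
𝔐 , I ⊨ (φ ∧′ ψ) = (𝔐 , I ⊨ φ) × (𝔐 , I ⊨ ψ)
𝔐 , I ⊨ (φ ∨′ ψ) = (𝔐 , I ⊨ φ) ⊎ (𝔐 , I ⊨ ψ)
𝔐 , I ⊨ (¬′ φ)   = ¬ (𝔐 , I ⊨ φ)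
𝔐 , I ⊨ (∃′ φ)   = ∃[ n ] 𝔐 , ⟪ n Vec.∷ fo I , so I ⟫ ⊨ φ
𝔐 , I ⊨ (∀′ φ)   = ∀ n → 𝔐 , ⟪ n Vec.∷ fo I , so I ⟫ ⊨ φ

------------------------------------------------------------------------
-- Infinite words

ω-Word : Set → Set
ω-Word Σ = ℕ → Σ

_++ω_ : ∀ {Σ : Set} → List Σ → ω-Word Σ → ω-Word Σ
([]      ++ω w) n       = w n
((a ∷ u) ++ω w) zero    = a
((a ∷ u) ++ω w) (suc n) = (u ++ω w) n

_^ω : ∀ {Σ : Set} → List⁺ Σ → ω-Word Σ
(v ^ω) n = List.lookup (List⁺.toList v) (n mod List⁺.length v)

UltimatelyPeriodic : ∀ {Σ : Set} → Pred (ω-Word Σ) 0ℓ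
UltimatelyPeriodic {Σ} w = Σ[ u ∈ List Σ ] Σ[ v ∈ List⁺ Σ ] w ≗ (u ++ω (v ^ω))

------------------------------------------------------------------------
-- Encodings and projection

Letter : ℕ → Set
Letter = Vec Bool

e : ∀ {k ℓ : ℕ} → Interpretation k ℓ → ω-Word (Letter (k + ℓ))
e I n = Vec.map (_≡ᵇ n) (fo I) Vec.++ Vec.map (λ X → X n) (so I)

L⟦_⟧ : ∀ {𝔐 : Structure} {k ℓ : ℕ} → Formula 𝔐 k ℓ → Pred (ω-Word (Letter (k + ℓ))) 0ℓ
L⟦_⟧ {𝔐} φ w = ∃[ I ] w ≗ e I × 𝔐 , I ⊨ φ

component : ∀ {k : ℕ} (ℓ : ℕ) → Fin (suc k) → Letter (suc k + ℓ) → Bool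
component ℓ i a = lookup a (i ↑ˡ ℓ)

Π≢ : ∀ {k : ℕ} (ℓ : ℕ) → Fin (suc k) → Letter (suc k + ℓ) → Letter (k + ℓ)
Π≢ ℓ i a = removeAt a (i ↑ˡ ℓ)

------------------------------------------------------------------------
-- Automata

-- The label nothing is ε.
record Automaton (Σ : Set) : Set₁ where
  field
    State : Set
    Δ     : State → Maybe Σ → State → Set
    Q₀    : Pred State 0ℓ
    F     : Pred State 0ℓ

-- Finiteness of the state set, and decidability of the sets Δ, Q₀ and F
-- (which, being finite sets given extensionally, are classically always
-- decidable).
record IsFinite {Σ : Set} (A : Automaton Σ) : Set where
  open Automaton A
  field
    size  : ℕ
    index : State ↔ Fin size
    Δ?    : ∀ p x → Decidable (Δ p x)
    Q₀?   : Decidable Q₀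
    F?    : Decidable F

module _ {Σ : Set} (A : Automaton Σ) where
  open Automaton A

  data Path : State → List Σ → State → Set where
    []   : ∀ {q} → Path q [] q
    ε∷   : ∀ {p q r u} → Δ p nothing q → Path q u r → Path p u r
    step : ∀ {p q r a u} → Δ p (just a) q → Path q u r → Path p (a ∷ u) r

  L[_,_] : State → State → Pred (List Σ) 0ℓ
  L[ q , r ] u = Path q u r

  Visits : ∀ {q u r} → Pred State 0ℓ → Path q u r → Set
  Visits {q} P []         = P q
  Visits {q} P (ε∷ _ π)   = P q ⊎ Visits P π
  Visits {q} P (step _ π) = P q ⊎ Visits P π

  Lfin : Pred (List Σ) 0ℓ
  Lfin u = ∃[ q ] ∃[ r ] Q₀ q × F r × Path q u r

  -- An infinite sequence of consecutive transitions.
  record TransitionSequence : Set where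
    field
      state : ℕ → State
      label : ℕ → Maybe Σ
      trans : ∀ t → Δ (state t) (label t) (state (suc t))

  module _ (ρ : TransitionSequence) where
    open TransitionSequence ρ

    lettersBefore : ℕ → ℕ
    lettersBefore t = List.length (List.catMaybes (List.applyUpTo label t))

    -- The (n+1)-th transition with a non-empty label exists and is labelled a.
    NthLetter : ℕ → Σ → Set
    NthLetter n a = ∃[ t ] label t ≡ just a × lettersBefore t ≡ n

    -- The concatenated labels form the infinite word w. In particular
    -- infinitely many labels are non-empty.
    Reads : ω-Word Σ → Set
    Reads w = ∀ n → NthLetter n (w n)

    Büchi : Set
    Büchi = ∃[ q ] F q × (∀ n → ∃[ t ] n ≤ t × state t ≡ q)

    StartsInitial : Set
    StartsInitial = Q₀ (state zero)

  Lω : Pred (ω-Word Σ) 0ℓ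
  Lω w = ∃[ ρ ] StartsInitial ρ × Büchi ρ × Reads ρ w

------------------------------------------------------------------------
-- The widget for the ω-power: the state nothing is q_repeat.

data WidgetΔ {Σ : Set} (B : Automaton Σ) :
    Maybe (Automaton.State B) → Maybe Σ → Maybe (Automaton.State B) → Set where
  inner : ∀ {p x q} → Automaton.Δ B p x q → WidgetΔ B (just p) x (just q)
  start : ∀ {q} → Automaton.Q₀ B q → WidgetΔ B nothing nothing (just q)
  loop  : ∀ {q} → Automaton.F B q → WidgetΔ B (just q) nothing nothing

widget : ∀ {Σ : Set} → Automaton Σ → Automaton Σ
widget B = record
  { State = Maybe (Automaton.State B)
  ; Δ     = WidgetΔ B
  ; Q₀    = _≡ nothing
  ; F     = _≡ nothing
  }

------------------------------------------------------------------------
-- The construction of 𝒜′ and 𝒜″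

module Construction {k ℓ : ℕ} (i : Fin (suc k))
                    (A : Automaton (Letter (suc k + ℓ))) (fin : IsFinite A) where
  open Automaton A
  open IsFinite fin

  private
    Σ′ : Set
    Σ′ = Letter (k + ℓ)

    proj : Letter (suc k + ℓ) → Σ′
    proj = Π≢ ℓ i

  _∈_ : State → Subset size → Set
  q ∈ S = Inverse.to index q Subset.∈ S

  ⟨_⟩ : State → Subset size
  ⟨ q ⟩ = ⁅ Inverse.to index q ⁆

  Q′ : Set
  Q′ = [ S ∈ Subset size ∣ Nonempty S ]

  Transition : Set
  Transition = State × Letter (suc k + ℓ) × State

  record LetterStep (S₁ : Subset size) (a′ : Σ′) (S₂ : Subset size) : Set where
    field
      T       : Transition → Bool
      T⊆Δ     : ∀ {p a q} → T (p , a , q) ≡ true → Δ p (just a) q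
      sources : ∀ p → p ∈ S₁ ⇔ (∃[ a ] ∃[ q ] T (p , a , q) ≡ true)
      targets : ∀ q → q ∈ S₂ ⇔ (∃[ p ] ∃[ a ] T (p , a , q) ≡ true)
      labels  : ∀ {p a q} → T (p , a , q) ≡ true → proj a ≡ a′
      unique  : ∃! _≡_ (λ t → T t ≡ true × component ℓ i (proj₁ (proj₂ t)) ≡ true)

  data Δ′ : Q′ → Maybe Σ′ → Q′ → Set where
    letter    : ∀ {S₁ a′ S₂} → LetterStep (value S₁) a′ (value S₂) → Δ′ S₁ (just a′) S₂
    ε-add     : ∀ {S₁ S₂ p q} → Δ p nothing q → p ∈ value S₁ →
                value S₂ ≡ value S₁ Subset.∪ ⟨ q ⟩ →
                Δ′ S₁ nothing S₂
    ε-replace : ∀ {S₁ S₂ p q} → Δ p nothing q → p ∈ value S₁ →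
                value S₂ ≡ (value S₁ Subset.─ ⟨ p ⟩) Subset.∪ ⟨ q ⟩ →
                Δ′ S₁ nothing S₂

  A′ : Automaton Σ′
  A′ = record
    { State = Q′
    ; Δ     = Δ′
    ; Q₀    = λ S → ∀ q → q ∈ value S → Q₀ q
    ; F     = λ _ → ⊤
    }

  -- The states q′ of 𝒜′ with q′ ∩ F ≠ ∅.
  Q′F : Set
  Q′F = [ S ∈ Q′ ∣ (∃[ q ] q ∈ value S × F q) ]

  -- The finite-word automata that the construction picks: any choice with
  -- the prescribed languages.
  record Choice : Set₁ where
    field
      Aloop     : State → Automaton Σ′
      Aloop-fin : ∀ q → IsFinite (Aloop q)
      Aloop-L   : ∀ q → Lfin (Aloop q) ≐
                  λ u → u ≢ [] ×
                        (∃[ v ] Σ[ π ∈ Path A q v q ] Visits A F π × List.map proj v ≡ u)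

      Aseg      : State → State → Automaton Σ′
      Aseg-fin  : ∀ q r → IsFinite (Aseg q r)
      Aseg-L    : ∀ q r → Lfin (Aseg q r) ≐
                  λ u → ∃[ v ] L[_,_] A q r v × List.map proj v ≡ u

    U : State → Pred (List Σ′) 0ℓ
    U q = ⋃[ r ∶ State ] (Lfin (Aseg q r) ∩ Lfin (Aloop r))

    U′ : Q′ → Pred (List Σ′) 0ℓ
    U′ S = L[_,_] A′ S S ∩ (λ u → ∀ q → q ∈ value S → U q u)

    field
      AU′     : Q′F → Automaton Σ′
      AU′-fin : ∀ S → IsFinite (AU′ S)
      AU′-L   : ∀ S → Lfin (AU′ S) ≐ U′ (value S)

  module _ (C : Choice) where
    open Choice C

    data Q″ : Set where
      base : Q′ → Q″
      wid  : (S : Q′F) → Automaton.State (widget (AU′ S)) → Q″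

    data Δ″ : Q″ → Maybe Σ′ → Q″ → Set where
      in-A′     : ∀ {S₁ x S₂} → Δ′ S₁ x S₂ → Δ″ (base S₁) x (base S₂)
      in-widget : ∀ {S p x q} → Automaton.Δ (widget (AU′ S)) p x q →
                  Δ″ (wid S p) x (wid S q)
      enter     : ∀ {S} → Δ″ (base (value S)) nothing (wid S nothing)

    data Q″₀ : Pred Q″ 0ℓ where
      initial : ∀ {S} → Automaton.Q₀ A′ S → Q″₀ (base S)

    data F″ : Pred Q″ 0ℓ where
      repeat : ∀ {S} → F″ (wid S nothing)

    A″ : Automaton Σ′
    A″ = record { State = Q″ ; Δ = Δ″ ; Q₀ = Q″₀ ; F = F″ }

{-# OPTIONS --safe #-}
module Submission where

-- Since 𝒜 accepts only encodings, each ρₙ carries its mark exactly at letter n.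
-- So for any M the runs ρ₀, …, ρ_M, moved in parallel as tokens on the states
-- of 𝒜, trace a path of 𝒜′ over the first M + 1 letters of w″: at letter m
-- only the transition of ρₘ is marked. At the positions where ρ₀ is in F we
-- look at the set of occupied states; with M large enough two such positions
-- m < m + L have the same set q′, and L can be taken divisible by the period
-- of w″ and by all small numbers. This is a loop of 𝒜′ on q′, and q′ ∩ F ≠ ∅.
-- From any state of q′ one of the runs ρₙ goes on to accept a periodic word;
-- cutting out cycles, it reaches within L letters an accepting loop whose
-- length divides L, which shows that the loop word is in U_q. Hence q′ with
-- its widget carries an accepting lasso of 𝒜″ on w″. Using finitely many runs
-- keeps the argument constructive.

open import Defs
open import Data.Bool using (true; T)
import Data.Bool.Properties as Bool
open import Data.Empty using (⊥-elim)
open import Data.Fin using (Fin; zero; toℕ; combine)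
import Data.Fin.Properties as Fin
open import Data.Fin.Properties
  using (toℕ<n; toℕ-fromℕ<; toℕ-injective; pigeonhole; combine-injective; 2↔Bool)
open import Data.Fin.Subset as Subset using (Subset; Nonempty; _∪_; _─_; ⁅_⁆)
open import Data.Fin.Subset.Properties
  using (⊆-antisym; x∈p∪q⁻; p⊆p∪q; q⊆p∪q; x∈⁅x⁆; x∈⁅y⁆⇒x≡y; p─q⊆p; x∈p∧x∉q⇒x∈p─q; ∉⊥; _∈?_;
         ∪-assoc; ∪-comm; ∪-identityˡ)
open import Data.Irrelevant using ([_])
open import Data.List as List using (List; []; _∷_; _++_; length; catMaybes; applyUpTo; fromMaybe)
open import Data.List.NonEmpty as List⁺ using (List⁺)
open import Data.List.Properties using (applyUpTo-∷ʳ; catMaybes-++; length-++; ++-identityʳ; map-++)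
open import Data.Maybe using (Maybe; just; nothing)
open import Data.Maybe.Properties using (just-injective)
open import Data.Nat
open import Data.Nat.Divisibility
  using (_∣_; divides-refl; ∣-trans; ∣⇒≤; m∣m*n; n∣m*n; ∣m+n∣m⇒∣n; m≤n⇒m!∣n!)
open import Data.Nat.DivMod
  using (_%_; _/_; _mod_; m≡m%n+[m/n]*n; [m+n]%n≡m%n; [m+kn]%n≡m%n; %-distribˡ-+)
open import Data.Nat.Induction using (<-rec)
open import Data.Nat.Properties
open import Data.Product using (∃; ∃₂; ∃-syntax; Σ-syntax; _×_; _,_; proj₁; proj₂)
open import Data.Product.Properties using (≡-dec)
open import Data.Refinement using (_,_; value; value-injective)
open import Data.Sum using (_⊎_; inj₁; inj₂)
open import Data.Vec as Vec using ([]; _∷_; here; there; lookup)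
import Data.Vec.Properties as Vec
open import Function using (_∘_; id)
open import Function.Bundles using (_↔_; Inverse; mk⇔)
open import Function.Properties.Inverse using (Inverse⇒Injection)
open import Level using (0ℓ)
open import Relation.Binary.Definitions using (DecidableEquality; tri<; tri≈; tri>)
open import Relation.Binary.PropositionalEquality
open import Relation.Nullary using (Dec; yes; no; does; contradiction; _because_; ofʸ)
open import Relation.Nullary.Decidable using (_×-dec_; via-injection; dec-true)
open import Relation.Unary using (Pred; _≐_)

private variable
  Σ Σ′ : Set

-- Finite windows of infinite words, and paths

window : ω-Word Σ → ℕ → ℕ → List Σ
window w m zero    = []
window w m (suc n) = w m ∷ window w (suc m) n

window-+ : ∀ (w : ω-Word Σ) m a b →
           window w m (a + b) ≡ window w m a ++ window w (m + a) b
window-+ w m zero    b rewrite +-identityʳ m = refl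
window-+ w m (suc a) b rewrite +-suc m a     = cong (w m ∷_) (window-+ w (suc m) a b)

window-cong : ∀ (w : ω-Word Σ) {m m′} → (∀ k → w (k + m) ≡ w (k + m′)) →
              ∀ n → window w m n ≡ window w m′ n
window-cong w eq zero = refl
window-cong w {m} {m′} eq (suc n) = cong₂ _∷_ (eq 0) (window-cong w eq′ n)
  where
  eq′ : ∀ k → w (k + suc m) ≡ w (k + suc m′)
  eq′ k rewrite +-suc k m | +-suc k m′ = eq (suc k)

window-++ω : ∀ (w : ω-Word Σ) m n {z} → (∀ k → w (k + (n + m)) ≡ z k) →
             ∀ k → w (k + m) ≡ (window w m n ++ω z) k
window-++ω w m zero    eq k       = eq k
window-++ω w m (suc n) eq zero    = refl
window-++ω w m (suc n) eq (suc k) =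
  trans (cong w (sym (+-suc k m)))
        (window-++ω w (suc m) n (λ j → trans (cong (λ x → w (j + x)) (+-suc n m)) (eq j)) k)

module _ {A : Automaton Σ} where
  open Automaton A

  _++ᵖ_ : ∀ {p q r u v} → Path A p u q → Path A q v r → Path A p (u ++ v) r
  []       ++ᵖ σ = σ
  ε∷ δ π   ++ᵖ σ = ε∷ δ (π ++ᵖ σ)
  step δ π ++ᵖ σ = step δ (π ++ᵖ σ)

  splitᵖ : ∀ u {v p r} → Path A p (u ++ v) r → ∃[ q ] Path A p u q × Path A q v r
  splitᵖ []      π          = _ , [] , π
  splitᵖ (a ∷ u) (ε∷ δ π)   with q , π₁ , π₂ ← splitᵖ (a ∷ u) π = q , ε∷ δ π₁ , π₂
  splitᵖ (a ∷ u) (step δ π) with q , π₁ , π₂ ← splitᵖ u π       = q , step δ π₁ , π₂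

  -- Isolates the letter transition: in the subset automaton all tokens must take theirs in one
  -- step, whereas the ε-moves before and after it are made token by token.
  letterᵖ : ∀ {p a r} → Path A p (a ∷ []) r →
            ∃₂ λ q q′ → Path A p [] q × Δ q (just a) q′ × Path A q′ [] r
  letterᵖ (ε∷ δ π)   with _ , _ , π₁ , δ′ , π₂ ← letterᵖ π = _ , _ , ε∷ δ π₁ , δ′ , π₂
  letterᵖ (step δ π) = _ , _ , [] , δ , π

mapᵖ : ∀ {A B : Automaton Σ} (f : Automaton.State A → Automaton.State B) →
       (∀ {p x q} → Automaton.Δ A p x q → Automaton.Δ B (f p) x (f q)) →
       ∀ {p u q} → Path A p u q → Path B (f p) u (f q)
mapᵖ f g []         = []
mapᵖ f g (ε∷ δ π)   = ε∷ (g δ) (mapᵖ f g π)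
mapᵖ f g (step δ π) = step (g δ) (mapᵖ f g π)

-- Counting the letters along a transition sequence

module _ {A : Automaton Σ} (ρ : TransitionSequence A) where
  open TransitionSequence ρ renaming (trans to move)

  lettersBefore-suc : ∀ t {x} → label t ≡ x →
                      lettersBefore A ρ (suc t) ≡ lettersBefore A ρ t + length (fromMaybe x)
  lettersBefore-suc t {x} refl = begin
    length (catMaybes (applyUpTo label (suc t)))
      ≡⟨ cong (length ∘ catMaybes) (applyUpTo-∷ʳ label t) ⟨
    length (catMaybes (applyUpTo label t ++ x ∷ []))
      ≡⟨ cong length (catMaybes-++ (applyUpTo label t) (x ∷ [])) ⟩
    length (catMaybes (applyUpTo label t) ++ catMaybes (x ∷ []))
      ≡⟨ length-++ (catMaybes (applyUpTo label t)) ⟩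
    lettersBefore A ρ t + length (catMaybes (x ∷ []))
      ≡⟨ cong (λ u → lettersBefore A ρ t + length u) (catMaybes-singleton x) ⟩
    lettersBefore A ρ t + length (fromMaybe x) ∎
    where
    open ≡-Reasoning
    catMaybes-singleton : ∀ y → catMaybes (y ∷ []) ≡ fromMaybe y
    catMaybes-singleton (just _) = refl
    catMaybes-singleton nothing  = refl

  lettersBefore-ε : ∀ t → label t ≡ nothing → lettersBefore A ρ (suc t) ≡ lettersBefore A ρ t
  lettersBefore-ε t eq = trans (lettersBefore-suc t eq) (+-identityʳ _)

  lettersBefore-letter : ∀ t {a} → label t ≡ just a →
                         lettersBefore A ρ (suc t) ≡ suc (lettersBefore A ρ t)
  lettersBefore-letter t eq = trans (lettersBefore-suc t eq) (+-comm _ 1)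

  lettersBefore-mono : ∀ {s t} → s ≤‴ t → lettersBefore A ρ s ≤ lettersBefore A ρ t
  lettersBefore-mono ≤‴-refl          = ≤-refl
  lettersBefore-mono {s} (≤‴-step s<t) =
    ≤-trans (≤-trans (m≤m+n _ _) (≤-reflexive (sym (lettersBefore-suc s refl))))
            (lettersBefore-mono s<t)

  lettersBefore-strict : ∀ s {t a} → label s ≡ just a → s < t →
                         lettersBefore A ρ s < lettersBefore A ρ t
  lettersBefore-strict s eq s<t =
    ≤-trans (≤-reflexive (sym (lettersBefore-letter s eq))) (lettersBefore-mono (≤⇒≤‴ s<t))

  lettersBefore-cancel-< : ∀ s t → lettersBefore A ρ s < lettersBefore A ρ t → s < t
  lettersBefore-cancel-< s t lt = ≰⇒> λ t≤s → <⇒≱ lt (lettersBefore-mono (≤⇒≤‴ t≤s))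

  -- The letter count strictly increases across a letter transition, so two such transitions with
  -- equal counts before them occur at the same time.
  NthLetter-unique : ∀ {n a b} → NthLetter A ρ n a → NthLetter A ρ n b → a ≡ b
  NthLetter-unique (s , s↦a , refl) (t , t↦b , eq) with <-cmp s t
  ... | tri< s<t _ _  = contradiction (sym eq) (<⇒≢ (lettersBefore-strict s s↦a s<t))
  ... | tri≈ _ refl _ = just-injective (trans (sym s↦a) t↦b)
  ... | tri> _ _ t<s  = contradiction eq (<⇒≢ (lettersBefore-strict t t↦b t<s))

-- The ω-word read by a lasso

module _ (A : Automaton Σ) where
  open Automaton A

  -- The first transition is kept apart from the rest, since a lasso must always have a next
  -- transition to take.
  record Path⁺ (p r : State) : Set where
    constructor _∷ᵖ_
    field
      {label} : Maybe Σ
      {mid}   : State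
      {word}  : List Σ
      move    : Δ p label mid
      rest    : Path A mid word r

    word⁺ : List Σ
    word⁺ = fromMaybe label ++ word

module Lasso (A : Automaton Σ) {q : Automaton.State A} (loop : Path⁺ A q q)
             {z : ω-Word Σ} (z-loop : z ≗ Path⁺.word⁺ loop ++ω z)
             (loop≢[] : Path⁺.word⁺ loop ≢ [])
             {p₀ : Automaton.State A} {u₀ : List Σ} (π₀ : Path A p₀ u₀ q)
             {w : ω-Word Σ} (w≗ : w ≗ u₀ ++ω z) where
  open Automaton A
  open Path⁺

  private
    unroll : ∀ {p u} → Path A p u q → Path⁺ A p q
    unroll []         = loop
    unroll (ε∷ δ π)   = δ ∷ᵖ π
    unroll (step δ π) = δ ∷ᵖ π

    unroll-word : ∀ {p u} (π : Path A p u q) → u ++ω z ≗ word⁺ (unroll π) ++ω z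
    unroll-word []         = z-loop
    unroll-word (ε∷ δ π)   = λ _ → refl
    unroll-word (step δ π) = λ _ → refl

    -- A configuration is the current state with the path still ahead up to `q`; when that path has
    -- ended, `unroll` puts the loop in its place.
    conf : ℕ → Σ[ p ∈ State ] Path⁺ A p q
    conf zero    = p₀ , unroll π₀
    conf (suc t) = _ , unroll (rest (proj₂ (conf t)))

  lasso : TransitionSequence A
  lasso = record
    { state = λ t → proj₁ (conf t)
    ; label = λ t → label (proj₂ (conf t))
    ; trans = λ t → move (proj₂ (conf t))
    }

  private
    lb : ℕ → ℕ
    lb = lettersBefore A lasso

    -- An invariant of the configurations: an ε-transition changes neither side, a letter transition
    -- drops the first letter of both, and putting in the loop is `z-loop`.
    tail : ∀ t k → w (lb t + k) ≡ (word⁺ (proj₂ (conf t)) ++ω z) k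
    tail zero    k = trans (w≗ k) (unroll-word π₀ k)
    tail (suc t) k with proj₂ (conf t) in eq | tail t
    ... | _∷ᵖ_ {nothing} δ π | ih =
      trans (cong (λ n → w (n + k)) (lettersBefore-ε lasso t (cong label eq)))
            (trans (ih k) (unroll-word π k))
    ... | _∷ᵖ_ {just a} δ π | ih =
      trans (cong (λ n → w (n + k)) (lettersBefore-letter lasso t (cong label eq)))
            (trans (cong w (sym (+-suc (lb t) k)))
                   (trans (ih (suc k)) (unroll-word π k)))

    -- `conf` stores the path after `unroll`. The path before it may be empty, which means arrival
    -- at `q` and is the base case of the recursions below.
    At : ∀ {p u} → ℕ → Path A p u q → Set
    At t π = conf t ≡ (_ , unroll π)

    unrolled : ∀ t → ∃₂ λ p u → Σ[ π ∈ Path A p u q ] At t π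
    unrolled zero    = _ , _ , π₀ , refl
    unrolled (suc t) = _ , _ , rest (proj₂ (conf t)) , refl

    after : ∀ {p} t {π : Path⁺ A p q} → conf t ≡ (p , π) → At (suc t) (rest π)
    after t eq = cong (λ c → _ , unroll (rest (proj₂ c))) eq

    return : ∀ {p u} t (π : Path A p u q) → At t π → ∃[ t′ ] t ≤ t′ × proj₁ (conf t′) ≡ q
    return t []         at = t , ≤-refl , cong proj₁ at
    return t (ε∷ δ π)   at with t′ , t<t′ , eq ← return (suc t) π (after t at) = t′ , <⇒≤ t<t′ , eq
    return t (step δ π) at with t′ , t<t′ , eq ← return (suc t) π (after t at) = t′ , <⇒≤ t<t′ , eq

    NextLetter : ℕ → Set
    NextLetter t = ∃₂ λ t′ a → label (proj₂ (conf t′)) ≡ just a × lb t′ ≡ lb t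

    skip-ε : ∀ t → label (proj₂ (conf t)) ≡ nothing → NextLetter (suc t) → NextLetter t
    skip-ε t ε (t′ , a , eq , lb≡) = t′ , a , eq , trans lb≡ (lettersBefore-ε lasso t ε)

    next-in-word : ∀ {p u} t (π : Path A p u q) → u ≢ [] → At t π → NextLetter t
    next-in-word t []         u≢[] at = contradiction refl u≢[]
    next-in-word t (ε∷ δ π)   u≢[] at =
      skip-ε t (cong (label ∘ proj₂) at) (next-in-word (suc t) π u≢[] (after t at))
    next-in-word t (step δ π) u≢[] at = t , _ , cong (label ∘ proj₂) at , refl

    next-in-loop : ∀ t (ℓ : Path⁺ A q q) → word⁺ ℓ ≢ [] → conf t ≡ (q , ℓ) → NextLetter t
    next-in-loop t (_∷ᵖ_ {just a}  δ π) ne at = t , a , cong (label ∘ proj₂) at , refl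
    next-in-loop t (_∷ᵖ_ {nothing} δ π) ne at =
      skip-ε t (cong (label ∘ proj₂) at) (next-in-word (suc t) π ne (after t at))

    -- The path ahead may consist of ε-transitions only, but then the loop follows, and its word is
    -- non-empty. The search thus enters the loop at most once and stays structural.
    next : ∀ {p u} t (π : Path A p u q) → At t π → NextLetter t
    next t []         at = next-in-loop t loop loop≢[] at
    next t (ε∷ δ π)   at = skip-ε t (cong (label ∘ proj₂) at) (next (suc t) π (after t at))
    next t (step δ π) at = t , _ , cong (label ∘ proj₂) at , refl

    letter : ∀ t {a} → label (proj₂ (conf t)) ≡ just a → w (lb t) ≡ a
    letter t {a} eq = trans (cong w (sym (+-identityʳ (lb t))))
                            (trans (tail t 0) (head (proj₂ (conf t)) eq))
      where
      head : ∀ {p} (π : Path⁺ A p q) → label π ≡ just a → (word⁺ π ++ω z) 0 ≡ a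
      head (_ ∷ᵖ _) refl = refl

    read : ∀ n t → lb t ≡ n → NthLetter A lasso n (w n)
    read n t refl with _ , _ , π , at ← unrolled t with t′ , a , eq , lb≡ ← next t π at =
      t′ , trans eq (cong just (trans (sym (letter t′ eq)) (cong w lb≡))) , lb≡

  lasso-reads : Reads A lasso w
  lasso-reads zero    = read 0 0 refl
  lasso-reads (suc n) with t , eq , lb≡ ← lasso-reads n =
    read (suc n) (suc t) (trans (lettersBefore-letter lasso t eq) (cong suc lb≡))

  lasso-recurs : ∀ n → ∃[ t ] n ≤ t × TransitionSequence.state lasso t ≡ q
  lasso-recurs n with _ , _ , π , at ← unrolled n = return n π at

-- Runs seen as one state before each letter

module _ (A : Automaton Σ) where
  open Automaton A

  -- `recurs` lets the accepting state vary with `n`; a repeated one is found later by the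
  -- pigeonhole principle.
  record Trajectory (w : ω-Word Σ) : Set where
    field
      origin  : State
      initial : Q₀ origin
      state   : ℕ → State
      launch  : Path A origin [] (state 0)
      advance : ∀ m → Path A (state m) (w m ∷ []) (state (suc m))
      recurs  : ∀ n → ∃[ m ] n ≤ m × F (state m)

  module _ (fin : IsFinite A) (ρ : TransitionSequence A) {w : ω-Word Σ}
           (start : StartsInitial A ρ) (büchi : Büchi A ρ) (reads : Reads A ρ w) where
    open TransitionSequence ρ renaming (trans to move)
    open IsFinite fin

    private
      lb : ℕ → ℕ
      lb = lettersBefore A ρ

      -- By `NthLetter-unique`, the label of a letter transition is the letter of `w` at the current
      -- count.
      segment : ∀ {s t} → s ≤‴ t → ∃[ n ] lb t ≡ lb s + n × Path A (state s) (window w (lb s) n) (state t)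
      segment ≤‴-refl = 0 , sym (+-identityʳ _) , []
      segment {s} (≤‴-step s<t) with label s in eq | move s | segment s<t
      ... | nothing | δ | n , lb≡ , π rewrite lettersBefore-ε ρ s eq = n , lb≡ , ε∷ δ π
      ... | just a  | δ | n , lb≡ , π
        rewrite lettersBefore-letter ρ s eq | NthLetter-unique ρ (s , eq , refl) (reads (lb s)) =
        suc n , trans lb≡ (sym (+-suc _ n)) , step δ π

      segment-at : ∀ s t m n → s ≤ t → lb s ≡ m → lb t ≡ m + n →
                   Path A (state s) (window w m n) (state t)
      segment-at s t _ n s≤t refl lb≡ with n′ , lb≡′ , π ← segment (≤⇒≤‴ s≤t)
        with refl ← +-cancelˡ-≡ (lb s) n n′ (trans (sym lb≡) lb≡′) = π

      -- Among the times between two letters, one in F is preferred, so that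
      -- the visits of F survive in the trajectory.
      Cut : ℕ → ℕ → Set
      Cut m t = lb t ≡ m × F (state t)

      Cut? : ∀ m t → Dec (Cut m t)
      Cut? m t = (lb t ≟ m) ×-dec F? (state t)

      search : ∀ m → Dec (∃[ t ] t < suc (proj₁ (reads m)) × Cut m t)
      search m = anyUpTo? (Cut? m) (suc (proj₁ (reads m)))

      pick : ∀ {m} → Dec (∃[ t ] t < suc (proj₁ (reads m)) × Cut m t) → ℕ
      pick {m} (yes (t , _)) = t
      -- The default is the time at which letter `m` is taken, which also has exactly `m` letters
      -- before it.
      pick {m} (no _)        = proj₁ (reads m)

      cut : ℕ → ℕ
      cut m = pick (search m)

      lb-cut : ∀ m → lb (cut m) ≡ m
      lb-cut m with search m
      ... | yes (_ , _ , eq , _) = eq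
      ... | no _                 = proj₂ (proj₂ (reads m))

      cut-F : ∀ {m t} → lb t ≡ m → F (state t) → F (state (cut m))
      cut-F {m} {t} eq Ft with search m
      ... | yes (_ , _ , _ , Ft′) = Ft′
      ... | no none = contradiction (t , t≤ , eq , Ft) none
        where
        t≤ : t < suc (proj₁ (reads m))
        -- Once letter `m` has been taken the count exceeds `m`, so the bounded search misses no
        -- time of this block.
        t≤ = s≤s (≮⇒≥ λ lt → <⇒≢ (lettersBefore-strict ρ _ (proj₁ (proj₂ (reads m))) lt)
                                 (trans (proj₂ (proj₂ (reads m))) (sym eq)))

      advance-cut : ∀ m → Path A (state (cut m)) (w m ∷ []) (state (cut (suc m)))
      advance-cut m = segment-at (cut m) (cut (suc m)) m 1
        (<⇒≤ (lettersBefore-cancel-< ρ _ _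
          (subst₂ _<_ (sym (lb-cut m)) (sym (lb-cut (suc m))) (n<1+n m))))
        (lb-cut m) (trans (lb-cut (suc m)) (+-comm 1 m))

    trajectory : Trajectory w
    trajectory = record
      { origin  = state 0
      ; initial = start
      ; state   = state ∘ cut
      ; launch  = launch
      ; advance = advance-cut
      ; recurs  = recurs
      }
      where
      launch : Path A (state 0) [] (state (cut 0))
      launch = segment-at 0 (cut 0) 0 0 z≤n refl (lb-cut 0)

      recurs : ∀ n → ∃[ m ] n ≤ m × F (state (cut m))
      -- A visit of `F` later than the transition that reads letter `n` has a count above `n`;
      -- `cut-F` transfers it to the cut with that count.
      recurs n with t , n≤t , refl ← proj₂ (proj₂ büchi) (suc (proj₁ (reads n))) =
        lb t , <⇒≤ (subst (_< lb t) (proj₂ (proj₂ (reads n)))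
                     (lettersBefore-strict ρ _ (proj₁ (proj₂ (reads n))) n≤t))
             , cut-F refl (proj₁ (proj₂ büchi))

-- Enumerating infinitely many positions, and congruences

module Enumeration {P : ℕ → Set} (inf : ∀ n → ∃[ m ] n ≤ m × P m) (start : ℕ) where

  enum : ℕ → ℕ
  enum zero    = proj₁ (inf start)
  enum (suc j) = proj₁ (inf (suc (enum j)))

  enum-P : ∀ j → P (enum j)
  enum-P zero    = proj₂ (proj₂ (inf start))
  enum-P (suc j) = proj₂ (proj₂ (inf (suc (enum j))))

  enum-< : ∀ {i j} → i <‴ j → enum i < enum j
  enum-< {i} ≤‴-refl        = proj₁ (proj₂ (inf (suc (enum i))))
  enum-< {i} (≤‴-step i<j)  = <-trans (enum-< {i} ≤‴-refl) (enum-< i<j)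

  enum-mono : ∀ {i j} → i < j → enum i < enum j
  enum-mono i<j = enum-< (≤⇒≤‴ i<j)

  start≤enum : ∀ j → start ≤ enum j
  start≤enum zero    = proj₁ (proj₂ (inf start))
  start≤enum (suc j) = ≤-trans (start≤enum j) (<⇒≤ (enum-mono (n<1+n j)))

module _ (d : ℕ) .{{_ : NonZero d}} where

  +-%-congˡ : ∀ m m′ k → m % d ≡ m′ % d → (m + k) % d ≡ (m′ + k) % d
  +-%-congˡ m m′ k eq = begin
    (m + k) % d              ≡⟨ %-distribˡ-+ m k d ⟩
    (m % d + k % d) % d      ≡⟨ cong (λ x → (x + k % d) % d) eq ⟩
    (m′ % d + k % d) % d     ≡⟨ %-distribˡ-+ m′ k d ⟨
    (m′ + k) % d             ∎
    where open ≡-Reasoning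

  -- Both sides are the common residue plus both multiples of `d`. This replaces subtraction:
  -- periodicity is applied upwards from two congruent positions to a common one.
  ≡%⇒+*≡+* : ∀ m m′ → m % d ≡ m′ % d → m + (m′ / d) * d ≡ m′ + (m / d) * d
  ≡%⇒+*≡+* m m′ eq = begin
    m + (m′ / d) * d                        ≡⟨ cong (_+ (m′ / d) * d) (m≡m%n+[m/n]*n m d) ⟩
    m % d + (m / d) * d + (m′ / d) * d      ≡⟨ +-assoc (m % d) _ _ ⟩
    m % d + ((m / d) * d + (m′ / d) * d)    ≡⟨ cong₂ _+_ eq (+-comm ((m / d) * d) _) ⟩
    m′ % d + ((m′ / d) * d + (m / d) * d)   ≡⟨ +-assoc (m′ % d) _ _ ⟨
    m′ % d + (m′ / d) * d + (m / d) * d     ≡⟨ cong (_+ (m / d) * d) (m≡m%n+[m/n]*n m′ d) ⟨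
    m′ + (m / d) * d                        ∎
    where open ≡-Reasoning

  mod-injective : ∀ m m′ → m mod d ≡ m′ mod d → m % d ≡ m′ % d
  mod-injective m m′ eq = trans (sym (toℕ-fromℕ< _)) (trans (cong toℕ eq) (toℕ-fromℕ< _))

  mod-cong : ∀ m m′ → m % d ≡ m′ % d → m mod d ≡ m′ mod d
  mod-cong m m′ eq = toℕ-injective (trans (toℕ-fromℕ< _) (trans eq (sym (toℕ-fromℕ< _))))

  +-∣-% : ∀ m {n} → d ∣ n → (m + n) % d ≡ m % d
  +-∣-% m (divides-refl q) = [m+kn]%n≡m%n m q d

  ≡%⇒∣+ : ∀ m n → m % d ≡ (m + n) % d → d ∣ n
  ≡%⇒∣+ m n eq = ∣m+n∣m⇒∣n (subst (d ∣_) (+-cancelˡ-≡ m _ _ (sym eq′)) (n∣m*n ((m + n) / d))) (n∣m*n (m / d))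
    where
    eq′ : m + ((m / d) * d + n) ≡ m + ((m + n) / d) * d
    eq′ = begin
      m + ((m / d) * d + n)   ≡⟨ cong (m +_) (+-comm _ n) ⟩
      m + (n + (m / d) * d)   ≡⟨ +-assoc m n _ ⟨
      m + n + (m / d) * d     ≡⟨ ≡%⇒+*≡+* m (m + n) eq ⟨
      m + ((m + n) / d) * d   ∎
      where open ≡-Reasoning

-- Pumping along eventually periodic words

record EventuallyPeriodic (w : ω-Word Σ) : Set where
  field
    threshold period : ℕ
    .{{period≢0}}    : NonZero period
    periodic         : ∀ m → threshold ≤ m → w (m + period) ≡ w m

  private
    periodic-* : ∀ c m → threshold ≤ m → w (m + c * period) ≡ w m
    periodic-* zero    m t≤m = cong w (+-identityʳ m)
    periodic-* (suc c) m t≤m =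
      trans (cong w (sym (+-assoc m period (c * period))))
            (trans (periodic-* c (m + period) (≤-trans t≤m (m≤m+n m period))) (periodic m t≤m))

  periodic-% : ∀ {m m′} → threshold ≤ m → threshold ≤ m′ → m % period ≡ m′ % period → w m ≡ w m′
  periodic-% {m} {m′} t≤m t≤m′ eq =
    trans (sym (periodic-* (m′ / period) m t≤m))
          (trans (cong w (≡%⇒+*≡+* period m m′ eq)) (periodic-* (m / period) m′ t≤m′))

  window-periodic : ∀ {m m′} → threshold ≤ m → threshold ≤ m′ → m % period ≡ m′ % period →
                    ∀ n → window w m n ≡ window w m′ n
  window-periodic {m} {m′} t≤m t≤m′ eq = window-cong w λ k →
    periodic-% (≤-trans t≤m (m≤n+m m k)) (≤-trans t≤m′ (m≤n+m m′ k))
      (subst₂ (λ x y → x % period ≡ y % period) (+-comm m k) (+-comm m′ k)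
        (+-%-congˡ period m m′ k eq))

++ω-skip : ∀ (u : List Σ) {z : ω-Word Σ} k → (u ++ω z) (length u + k) ≡ z k
++ω-skip []      k = refl
++ω-skip (_ ∷ u) k = ++ω-skip u k

eventuallyPeriodic : ∀ {w : ω-Word Σ} → UltimatelyPeriodic w → EventuallyPeriodic w
eventuallyPeriodic {w = w} (u , v , w≗) = record
  { threshold = length u
  ; period    = List⁺.length v
  ; periodic  = periodic
  }
  where
  d = List⁺.length v
  value-at : ∀ k → w (length u + k) ≡ (v ^ω) k
  value-at k = trans (w≗ _) (++ω-skip u k)

  periodic : ∀ m → length u ≤ m → w (m + d) ≡ w m
  periodic m u≤m with k , refl ← m≤n⇒∃[o]m+o≡n u≤m = begin
    w (length u + k + d)     ≡⟨ cong w (+-assoc (length u) k d) ⟩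
    w (length u + (k + d))   ≡⟨ value-at (k + d) ⟩
    (v ^ω) (k + d)           ≡⟨ cong (List.lookup (List⁺.toList v)) (mod-cong d (k + d) k ([m+n]%n≡m%n k d)) ⟩
    (v ^ω) k                 ≡⟨ value-at k ⟨
    w (length u + k)         ∎
    where open ≡-Reasoning

n∣n! : ∀ {n} → 0 < n → n ∣ n !
n∣n! {suc n} _ = m∣m*n (n !)

-- Numbers the subsets, so that the pigeonhole principle for `Fin` applies to them.
code : ∀ {n} → Subset n → Fin (2 ^ n)
code []      = zero
code (b ∷ S) = combine (Inverse.from 2↔Bool b) (code S)

code-injective : ∀ {n} {S S′ : Subset n} → code S ≡ code S′ → S ≡ S′
code-injective {S = []}    {[]}     eq = refl
code-injective {S = b ∷ S} {b′ ∷ S′} eq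
  with b≡ , S≡ ← combine-injective (Inverse.from 2↔Bool b) (code S) (Inverse.from 2↔Bool b′) (code S′) eq =
  cong₂ _∷_ (trans (sym (Inverse.strictlyInverseˡ 2↔Bool b))
                   (trans (cong (Inverse.to 2↔Bool) b≡) (Inverse.strictlyInverseˡ 2↔Bool b′)))
            (code-injective S≡)

module Pumping (B : Automaton Σ) {size : ℕ} (index : Automaton.State B ↔ Fin size)
               {w : ω-Word Σ} (ep : EventuallyPeriodic w) where
  open Automaton B
  open EventuallyPeriodic ep renaming (period to d)

  Segment : State → ℕ → ℕ → State → Set
  Segment p m n q = Path B p (window w m n) q

  join : ∀ {p q r} m a {b} → Segment p m a q → Segment q (m + a) b r → Segment p m (a + b) r
  join m a {b} π σ = subst (λ u → Path B _ u _) (sym (window-+ w m a b)) (π ++ᵖ σ)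

  cut : ∀ {p r} m a {b} → Segment p m (a + b) r →
        ∃[ q ] Segment p m a q × Segment q (m + a) b r
  cut m a {b} π = splitᵖ (window w m a) (subst (λ u → Path B _ u _) (window-+ w m a b) π)

  shift : ∀ {p q m m′ n} → threshold ≤ m → threshold ≤ m′ → m % d ≡ m′ % d →
          Segment p m n q → Segment p m′ n q
  shift {n = n} t≤m t≤m′ eq = subst (λ u → Path B _ u _) (window-periodic t≤m t≤m′ eq n)

  loop^ : ∀ {q m n} → threshold ≤ m → (m + n) % d ≡ m % d →
          Segment q m n q → ∀ c → Segment q m (c * n) q
  loop^ t≤m eq π zero    = []
  loop^ {m = m} {n} t≤m eq π (suc c) =
    join m n π (shift t≤m (≤-trans t≤m (m≤m+n m n)) (sym eq) (loop^ t≤m eq π c))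

  -- The number of pairs of a state and a position modulo the period. Two points of a segment with
  -- the same pair enclose a cycle that can be cut out.
  bound : ℕ
  bound = size * d

  key : State → ℕ → Fin bound
  key q m = combine (Inverse.to index q) (m mod d)

  key-injective : ∀ q q′ m m′ → key q m ≡ key q′ m′ → q ≡ q′ × m % d ≡ m′ % d
  key-injective q q′ m m′ eq with q≡ , m≡ ← combine-injective (Inverse.to index q) _ (Inverse.to index q′) _ eq =
    trans (sym (Inverse.strictlyInverseʳ index q))
          (trans (cong (Inverse.from index) q≡) (Inverse.strictlyInverseʳ index q′))
    , mod-injective d m m′ m≡

  -- The congruence of end positions lets whatever follows the segment be shifted along; the first
  -- condition keeps loops non-empty.
  Shorter : State → ℕ → ℕ → State → ℕ → Set
  Shorter p m n q n′ = (0 < n → 0 < n′) × (m + n′) % d ≡ (m + n) % d × Segment p m n′ q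

  module _ {p q : State} {m n : ℕ} (bound<n : bound < n) (π : Segment p m n q) where
    private
      -- The cut points are 1 to `suc bound`, without 0, so the first letter survives and the
      -- shortened segment is non-empty.
      rest : Fin (suc bound) → ℕ
      rest c = n ∸ suc (toℕ c)

      length≡ : ∀ c → suc (toℕ c) + rest c ≡ n
      length≡ c = m+[n∸m]≡n (≤-trans (toℕ<n c) bound<n)

      middle : ∀ c → ∃[ z ] Segment p m (suc (toℕ c)) z × Segment z (m + suc (toℕ c)) (rest c) q
      middle c = cut m (suc (toℕ c)) (subst (λ l → Segment p m l q) (sym (length≡ c)) π)

    remove-cycle : threshold ≤ m → ∃[ n′ ] n′ < n × Shorter p m n q n′
    remove-cycle t≤m
      with i , j , i<j , key≡ ← pigeonhole (n<1+n bound) (λ c → key (proj₁ (middle c)) (m + suc (toℕ c)))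
      with z≡ , pos≡ ← key-injective (proj₁ (middle i)) (proj₁ (middle j))
                              (m + suc (toℕ i)) (m + suc (toℕ j)) key≡ =
        suc (toℕ i) + rest j
      , subst (suc (toℕ i) + rest j <_) (length≡ j) (+-monoˡ-< (rest j) (s≤s i<j))
      , (λ _ → z<s)
      , cong%
      , join m (suc (toℕ i)) (proj₁ (proj₂ (middle i)))
             (subst (λ z → Segment z (m + suc (toℕ i)) (rest j) q) (sym z≡)
               (shift (≤-trans t≤m (m≤m+n m _)) (≤-trans t≤m (m≤m+n m _)) (sym pos≡)
                 (proj₂ (proj₂ (middle j)))))
      where
      cong% : (m + (suc (toℕ i) + rest j)) % d ≡ (m + n) % d
      cong% = begin
        (m + (suc (toℕ i) + rest j)) % d   ≡⟨ cong (_% d) (+-assoc m _ _) ⟨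
        (m + suc (toℕ i) + rest j) % d     ≡⟨ +-%-congˡ d (m + suc (toℕ i)) (m + suc (toℕ j)) (rest j) pos≡ ⟩
        (m + suc (toℕ j) + rest j) % d     ≡⟨ cong (_% d) (+-assoc m _ _) ⟩
        (m + (suc (toℕ j) + rest j)) % d   ≡⟨ cong (λ l → (m + l) % d) (length≡ j) ⟩
        (m + n) % d                        ∎
        where open ≡-Reasoning

  Short : State → ℕ → State → ℕ → Set
  Short p m q n = Segment p m n q → ∃[ n′ ] n′ ≤ bound × Shorter p m n q n′

  shorten : ∀ {p q m} → threshold ≤ m → ∀ n → Short p m q n
  shorten {p} {q} {m} t≤m = <-rec (Short p m q) λ n ih → go n ih (≤-<-connex n bound)
    where
    go : ∀ n → (∀ {l} → l < n → Short p m q l) → n ≤ bound ⊎ bound < n → Short p m q n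
    go n ih (inj₁ n≤bound) π = n , n≤bound , id , refl , π
    go n ih (inj₂ bound<n) π = resume (remove-cycle bound<n π t≤m)
      where
      resume : ∃[ l ] l < n × Shorter p m n q l → ∃[ n′ ] n′ ≤ bound × Shorter p m n q n′
      resume (l , l<n , pos , eq , σ) with n′ , n′≤bound , pos′ , eq′ , τ ← ih l<n σ =
        n′ , n′≤bound , pos′ ∘ pos , trans eq′ eq , τ

  AcceptingLoop : State → ℕ → Set
  AcceptingLoop p m = ∃ λ f → F f × ∃₂ λ a b → a ≤ bound × 0 < b × b ≤ bound ×
    (m + a + b) % d ≡ (m + a) % d × Segment p m a f × Segment f (m + a) b f

  -- The form that `U` asks for: the segment to `r` and the loop at `r`, split at its visit of `f`,
  -- read the same `L` letters from position `m`.
  Rotated : State → ℕ → ℕ → State → Set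
  Rotated p m L f = ∃ λ r → ∃₂ λ a b → a + b ≡ L ×
    Segment p m (a + b) r × Segment r m a f × Segment f (m + a) b r

  -- The loop of f is repeated up to the length L and then rotated, so that
  -- the segment entering it has length L as well.
  rotate : ∀ {p f m a b L} → threshold ≤ m → d ∣ L → a ≤ L → b ∣ L → (m + a + b) % d ≡ (m + a) % d →
           Segment p m a f → Segment f (m + a) b f → Rotated p m L f
  rotate {p} {f} {m} {a} {b} t≤m d∣L a≤L (divides-refl c) b% to-f at-f
    with r , f-to-r , r-to-f ← cut (m + a) (c * b ∸ a)
           (subst (λ l → Segment f (m + a) l f) (sym (m∸n+n≡m a≤L))
             (loop^ (≤-trans t≤m (m≤m+n m a)) b% at-f c)) =
      r , a , c * b ∸ a , a+rest≡L
    , join m a to-f f-to-r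
    , shift (≤-trans t≤m (≤-trans (m≤m+n m a) (m≤m+n (m + a) _))) t≤m
        (trans (cong (_% d) (trans (+-assoc m a _) (cong (m +_) a+rest≡L))) (+-∣-% d m d∣L))
        r-to-f
    , f-to-r
    where
    a+rest≡L : a + (c * b ∸ a) ≡ c * b
    a+rest≡L = m+[n∸m]≡n a≤L

  module _ {x : ℕ → State} (advance : ∀ m → Path B (x m) (w m ∷ []) (x (suc m))) where

    follow : ∀ m n → Segment (x m) m n (x (m + n))
    follow m zero    rewrite +-identityʳ m = []
    follow m (suc n) rewrite +-suc m n     = advance m ++ᵖ follow (suc m) n

    module _ (inf : ∀ n → ∃[ m ] n ≤ m × F (x m)) (m : ℕ) where
      open Enumeration inf m

      private
        visit : Fin (suc bound) → ℕ
        visit c = enum (toℕ c)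

      -- Among `suc bound` visits of `F` after `m`, two agree in state and in position modulo the
      -- period. The way to the first and the loop between them are then shortened separately.
      accepting-loop : threshold ≤ m → AcceptingLoop (x m) m
      accepting-loop t≤m
        with i , j , i<j , key≡ ← pigeonhole (n<1+n bound) (λ c → key (x (visit c)) (visit c))
        with xi≡xj , i%≡j% ← key-injective (x (visit i)) (x (visit j)) (visit i) (visit j) key≡
        with a₀ , eqa ← m≤n⇒∃[o]m+o≡n (start≤enum (toℕ i))
        with b₀ , eqb ← m≤n⇒∃[o]m+o≡n (<⇒≤ (enum-mono i<j))
        with a , a≤bound , _ , a% , to-f ← shorten t≤m a₀ (follow m a₀)
        with b , b≤bound , 0<b , b% , at-f ← shorten (≤-trans t≤m (start≤enum (toℕ i))) b₀
               (subst (Segment _ _ b₀) (trans (cong x eqb) (sym xi≡xj)) (follow (visit i) b₀)) =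
          x (visit i) , enum-P (toℕ i) , a , b , a≤bound
        -- The two visits are at distinct positions, so the loop is non-empty, and shortening keeps
        -- it so.
        , 0<b (+-cancelˡ-< (visit i) 0 b₀ (subst₂ _<_ (sym (+-identityʳ _)) (sym eqb) (enum-mono i<j)))
        , b≤bound
        , trans (+-%-congˡ d (m + a) (visit i) b pos≡) (trans loop% (sym pos≡))
        , subst (Segment _ m a ∘ x) eqa to-f
        , shift (≤-trans t≤m (start≤enum (toℕ i))) (≤-trans t≤m (m≤m+n m a)) (sym pos≡) at-f
        where
        pos≡ : (m + a) % d ≡ visit i % d
        pos≡ = trans a% (cong (_% d) eqa)
        loop% : (visit i + b) % d ≡ visit i % d
        loop% = trans b% (trans (cong (_% d) eqb) (sym i%≡j%))

    abstract
      pump : (∀ n → ∃[ m ] n ≤ m × F (x m)) → ∀ {m} → threshold ≤ m →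
             ∀ {L} → d ∣ L → bound ≤ L → (∀ {b} → 0 < b → b ≤ bound → b ∣ L) →
             ∃[ f ] F f × Rotated (x m) m L f
      pump inf {m} t≤m {L} d∣L bound≤L div = finish (accepting-loop inf m t≤m)
        where
        finish : AcceptingLoop (x m) m → ∃[ f ] F f × Rotated (x m) m L f
        finish (f , Ff , a , b , a≤bound , 0<b , b≤bound , b% , to-f , at-f) =
          f , Ff , rotate t≤m d∣L (≤-trans a≤bound bound≤L) (div 0<b b≤bound) b% to-f at-f

-- Projected automata, visits, and sets with one element added or removed

-- Pumping takes place here, on the periodic projected word. `U` constrains only projections, so
-- cutting and repeating need not respect the marks.
project : (Σ → Σ′) → Automaton Σ → Automaton Σ′
project {Σ} {Σ′} f A = record { State = State ; Δ = Δᶠ ; Q₀ = Q₀ ; F = F }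
  where
  open Automaton A
  Δᶠ : State → Maybe Σ′ → State → Set
  Δᶠ p nothing  q = Δ p nothing q
  Δᶠ p (just b) q = ∃[ a ] f a ≡ b × Δ p (just a) q

module _ {f : Σ → Σ′} {A : Automaton Σ} where

  projectᵖ : ∀ {p v q} → Path A p v q → Path (project f A) p (List.map f v) q
  projectᵖ []         = []
  projectᵖ (ε∷ δ π)   = ε∷ δ (projectᵖ π)
  projectᵖ (step δ π) = step (_ , refl , δ) (projectᵖ π)

  liftᵖ : ∀ {p u q} → Path (project f A) p u q → ∃[ v ] Path A p v q × List.map f v ≡ u
  liftᵖ []                      = _ , [] , refl
  liftᵖ (ε∷ δ π)                with _ , σ , eq ← liftᵖ π = _ , ε∷ δ σ , eq
  liftᵖ (step (a , refl , δ) π) with _ , σ , eq ← liftᵖ π = _ , step δ σ , cong (f a ∷_) eq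

module _ {A : Automaton Σ} {P : Pred (Automaton.State A) 0ℓ} where

  visits-start : ∀ {p u q} (π : Path A p u q) → P p → Visits A P π
  visits-start []         Pp = Pp
  visits-start (ε∷ _ _)   Pp = inj₁ Pp
  visits-start (step _ _) Pp = inj₁ Pp

  visits-junction : ∀ {p u q v r} (π : Path A p u q) (σ : Path A q v r) → P q → Visits A P (π ++ᵖ σ)
  visits-junction []         σ Pq = visits-start σ Pq
  visits-junction (ε∷ _ π)   σ Pq = inj₂ (visits-junction π σ Pq)
  visits-junction (step _ π) σ Pq = inj₂ (visits-junction π σ Pq)

does⁻ : ∀ {P : Set} (P? : Dec P) → does P? ≡ true → P
does⁻ (true because ofʸ p) _ = p

x∈p⇒p∪⁅x⁆≡p : ∀ {n x} {p : Subset n} → x Subset.∈ p → p ∪ ⁅ x ⁆ ≡ p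
x∈p⇒p∪⁅x⁆≡p {x = x} {p} x∈p = ⊆-antisym
  (λ y∈ → case (x∈p∪q⁻ p ⁅ x ⁆ y∈))
  (p⊆p∪q ⁅ x ⁆)
  where
  case : ∀ {y} → y Subset.∈ p ⊎ y Subset.∈ ⁅ x ⁆ → y Subset.∈ p
  case (inj₁ y∈p) = y∈p
  case (inj₂ y∈x) = subst (Subset._∈ p) (sym (x∈⁅y⁆⇒x≡y x y∈x)) x∈p

x∉p⇒p∪⁅x⁆─⁅x⁆≡p : ∀ {n x} {p : Subset n} → x Subset.∉ p → (p ∪ ⁅ x ⁆) ─ ⁅ x ⁆ ≡ p
x∉p⇒p∪⁅x⁆─⁅x⁆≡p {x = x} {p} x∉p = ⊆-antisym to from
  where
  to : (p ∪ ⁅ x ⁆) ─ ⁅ x ⁆ Subset.⊆ p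
  to {y} y∈ with x∈p∪q⁻ p ⁅ x ⁆ (p─q⊆p (p ∪ ⁅ x ⁆) ⁅ x ⁆ y∈)
  ... | inj₁ y∈p = y∈p
  ... | inj₂ y∈x = ⊥-elim (p─q-disjoint (p ∪ ⁅ x ⁆) ⁅ x ⁆ y∈ y∈x)
    where
    p─q-disjoint : ∀ {n x} (p q : Subset n) → x Subset.∈ p ─ q → x Subset.∉ q
    p─q-disjoint (_ ∷ p) (_ ∷ q) (there x∈) (there x∈q) = p─q-disjoint p q x∈ x∈q
    p─q-disjoint (true ∷ p) (true ∷ q) () here
  from : p Subset.⊆ (p ∪ ⁅ x ⁆) ─ ⁅ x ⁆
  from {y} y∈p = x∈p∧x∉q⇒x∈p─q (p⊆p∪q ⁅ x ⁆ y∈p)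
    (λ y∈x → x∉p (subst (Subset._∈ p) (x∈⁅y⁆⇒x≡y x y∈x) y∈p))

-- Finitely many runs as one path of 𝒜′

module Tokens {k ℓ : ℕ} (i : Fin (suc k)) (A : Automaton (Letter (suc k + ℓ))) (fin : IsFinite A) where
  open Automaton A
  open IsFinite fin
  open Construction {k} {ℓ} i A fin

  index-injective : ∀ {p q} → Inverse.to index p ≡ Inverse.to index q → p ≡ q
  index-injective {p} {q} eq =
    trans (sym (Inverse.strictlyInverseʳ index p))
          (trans (cong (Inverse.from index) eq) (Inverse.strictlyInverseʳ index q))

  _≟ˢ_ : DecidableEquality State
  _≟ˢ_ = via-injection (Inverse⇒Injection index) Fin._≟_

  _≟ᵗ_ : DecidableEquality Transition
  _≟ᵗ_ = ≡-dec _≟ˢ_ (≡-dec (Vec.≡-dec Bool._≟_) _≟ˢ_)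

  tokens : ℕ → (ℕ → State) → Subset size
  tokens zero    X = Subset.⊥
  tokens (suc M) X = tokens M X ∪ ⟨ X M ⟩

  ∈-∪⟨⟩ : ∀ S q → q ∈ (S ∪ ⟨ q ⟩)
  ∈-∪⟨⟩ S q = q⊆p∪q S (⟨ q ⟩) (x∈⁅x⁆ _)

  ∪⟨⟩-nonempty : ∀ S q → Nonempty (S ∪ ⟨ q ⟩)
  ∪⟨⟩-nonempty S q = _ , ∈-∪⟨⟩ S q

  ∈-tokens⁺ : ∀ M {X n} → n < M → X n ∈ tokens M X
  ∈-tokens⁺ (suc M) {X} {n} n<1+M with m≤n⇒m<n∨m≡n (s≤s⁻¹ n<1+M)
  ... | inj₁ n<M  = p⊆p∪q (⟨ X M ⟩) (∈-tokens⁺ M n<M)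
  ... | inj₂ refl = ∈-∪⟨⟩ (tokens M X) (X M)

  ∈-tokens⁻ : ∀ M {X q} → q ∈ tokens M X → ∃[ n ] n < M × X n ≡ q
  ∈-tokens⁻ zero            q∈ = contradiction q∈ ∉⊥
  ∈-tokens⁻ (suc M) {X} {q} q∈ with x∈p∪q⁻ (tokens M X) (⟨ X M ⟩) q∈
  ... | inj₁ q∈M with n , n<M , eq ← ∈-tokens⁻ M q∈M = n , m<n⇒m<1+n n<M , eq
  ... | inj₂ q∈⟨⟩ = M , n<1+n M , sym (index-injective (x∈⁅y⁆⇒x≡y _ q∈⟨⟩))

  -- Quantifying over irrelevant non-emptiness proofs leaves a relation on plain subsets, which can
  -- be transported along the identities of unions.
  _⇝_ : Subset size → Subset size → Set
  S ⇝ S′ = ∀ .(ne : Nonempty S) .(ne′ : Nonempty S′) → Path A′ (S , [ ne ]) [] (S′ , [ ne′ ])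

  ⇝-trans : ∀ {S₁ S₂ S₃} → .(Nonempty S₂) → S₁ ⇝ S₂ → S₂ ⇝ S₃ → S₁ ⇝ S₃
  ⇝-trans ne₂ π σ ne₁ ne₃ = π ne₁ ne₂ ++ᵖ σ ne₂ ne₃

  -- A token leaving p is replaced by an ε-replace transition, unless p is
  -- also occupied by another token: then an ε-add transition is used.
  ε-move : ∀ {S p q} → Δ p nothing q → (S ∪ ⟨ p ⟩) ⇝ (S ∪ ⟨ q ⟩)
  ε-move {S} {p} {q} δ ne ne′ with Inverse.to index p ∈? S
  ... | yes p∈S = ε∷ (ε-add δ (∈-∪⟨⟩ S p) (cong (_∪ ⟨ q ⟩) (sym (x∈p⇒p∪⁅x⁆≡p p∈S)))) []
  ... | no  p∉S = ε∷ (ε-replace δ (∈-∪⟨⟩ S p) (cong (_∪ ⟨ q ⟩) (sym (x∉p⇒p∪⁅x⁆─⁅x⁆≡p p∉S)))) []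

  token-move : ∀ {S p q} → Path A p [] q → (S ∪ ⟨ p ⟩) ⇝ (S ∪ ⟨ q ⟩)
  token-move []               _ _ = []
  token-move {S} (ε∷ {q = q} δ π) = ⇝-trans (∪⟨⟩-nonempty S q) (ε-move δ) (token-move π)

  private
    -- `S` holds tokens that stand still. In the induction the last token waits there while the
    -- earlier ones move; then it moves while they wait.
    tokens-move-∪ : ∀ M {X Y} S → (∀ n → Path A (X n) [] (Y n)) → (S ∪ tokens M X) ⇝ (S ∪ tokens M Y)
    tokens-move-∪ zero    S π _ _ = []
    tokens-move-∪ (suc M) {X} {Y} S π =
      subst₂ _⇝_ (right-comm (⟨ X M ⟩) (tokens M X)) (∪-assoc S (tokens M Y) (⟨ Y M ⟩))
        (⇝-trans (subst Nonempty (sym (comm (⟨ X M ⟩) (tokens M Y))) (∪⟨⟩-nonempty (S ∪ tokens M Y) (X M)))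
          (tokens-move-∪ M (S ∪ ⟨ X M ⟩) π)
          (subst (_⇝ ((S ∪ tokens M Y) ∪ ⟨ Y M ⟩)) (sym (comm (⟨ X M ⟩) (tokens M Y))) (token-move (π M))))
      where
      right-comm : ∀ p q → (S ∪ p) ∪ q ≡ S ∪ (q ∪ p)
      right-comm p q = trans (∪-assoc S p q) (cong (S ∪_) (∪-comm p q))
      comm : ∀ p q → (S ∪ p) ∪ q ≡ (S ∪ q) ∪ p
      comm p q = trans (right-comm p q) (sym (∪-assoc S q p))

  tokens-move : ∀ M {X Y} → (∀ n → Path A (X n) [] (Y n)) → tokens M X ⇝ tokens M Y
  tokens-move M {X} {Y} π =
    subst₂ _⇝_ (∪-identityˡ (tokens M X)) (∪-identityˡ (tokens M Y)) (tokens-move-∪ M Subset.⊥ π)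

  -- `T` consists of the transitions of the tokens below `M`, decided by bounded search. Tokens with
  -- the same transition merge, and a marked transition can only be that of token `m`.
  letterStep : ∀ {X Y a′} (a : ℕ → Letter (suc k + ℓ)) → (∀ n → Δ (X n) (just (a n)) (Y n)) →
               (∀ n → Π≢ ℓ i (a n) ≡ a′) →
               ∀ {m M} → m < M → component ℓ i (a m) ≡ true →
               (∀ n → component ℓ i (a n) ≡ true → n ≡ m) →
               LetterStep (tokens M X) a′ (tokens M Y)
  letterStep {X} {Y} {a′} a δ proj≡ {m} {M} m<M marked only = record
    { T       = does ∘ used?
    ; T⊆Δ     = λ t → T⊆Δ (does⁻ (used? _) t)
    ; sources = λ p → mk⇔ (λ p∈ → source⁺ (∈-tokens⁻ M p∈)) (λ (a , q , t) → source⁻ (does⁻ (used? _) t))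
    ; targets = λ q → mk⇔ (λ q∈ → target⁺ (∈-tokens⁻ M q∈)) (λ (p , a , t) → target⁻ (does⁻ (used? _) t))
    ; labels  = λ t → label≡ (does⁻ (used? _) t)
    ; unique  = trans-of m , (dec-true (used? _) (m , m<M , refl) , marked)
              , λ (t , mark) → same (does⁻ (used? _) t) mark
    }
    where
    trans-of : ℕ → Transition
    trans-of n = X n , a n , Y n

    Used : Transition → Set
    Used t = ∃[ n ] n < M × trans-of n ≡ t

    used? : ∀ t → Dec (Used t)
    used? t = anyUpTo? (λ n → trans-of n ≟ᵗ t) M

    T⊆Δ : ∀ {p b q} → Used (p , b , q) → Δ p (just b) q
    T⊆Δ (n , _ , refl) = δ n

    source⁺ : ∀ {p} → ∃[ n ] n < M × X n ≡ p → ∃[ b ] ∃[ q ] does (used? (p , b , q)) ≡ true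
    source⁺ (n , n<M , refl) = a n , Y n , dec-true (used? _) (n , n<M , refl)

    source⁻ : ∀ {p b q} → Used (p , b , q) → p ∈ tokens M X
    source⁻ (n , n<M , refl) = ∈-tokens⁺ M n<M

    target⁺ : ∀ {q} → ∃[ n ] n < M × Y n ≡ q → ∃[ p ] ∃[ b ] does (used? (p , b , q)) ≡ true
    target⁺ (n , n<M , refl) = X n , a n , dec-true (used? _) (n , n<M , refl)

    target⁻ : ∀ {p b q} → Used (p , b , q) → q ∈ tokens M Y
    target⁻ (n , n<M , refl) = ∈-tokens⁺ M n<M

    label≡ : ∀ {p b q} → Used (p , b , q) → Π≢ ℓ i b ≡ a′
    label≡ (n , _ , refl) = proj≡ n

    same : ∀ {t} → Used t → component ℓ i (proj₁ (proj₂ t)) ≡ true → trans-of m ≡ t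
    same (n , _ , refl) mark = cong trans-of (sym (only n mark))

  module Travel {w : ω-Word (Letter (k + ℓ))} (word : ℕ → ω-Word (Letter (suc k + ℓ)))
                (proj≡ : ∀ n m → Π≢ ℓ i (word n m) ≡ w m)
                (marked : ∀ m → component ℓ i (word m m) ≡ true)
                (only : ∀ m n → component ℓ i (word n m) ≡ true → n ≡ m)
                (x : ℕ → ℕ → State)
                (advance : ∀ n m → Path A (x n m) (word n m ∷ []) (x n (suc m)))
                (M : ℕ) where

    at : ℕ → Q′
    at m = tokens (suc M) (λ n → x n m) , [ ∪⟨⟩-nonempty _ (x M m) ]

    -- The transition marked at letter `m` is that of token `m`, which must be among the tokens 0 to
    -- `M`; hence the bound.
    advance-at : ∀ m → m ≤ M → Path A′ (at m) (w m ∷ []) (at (suc m))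
    advance-at m m≤M =
      tokens-move (suc M) (λ n → proj₁ (pieces n)) _ (∪⟨⟩-nonempty _ (src M)) ++ᵖ
      step {q = _ , [ ∪⟨⟩-nonempty _ (tgt M) ]}
        (letter (letterStep (λ n → word n m) (λ n → proj₁ (proj₂ (pieces n))) (λ n → proj≡ n m)
                            (s≤s m≤M) (marked m) (only m)))
        (tokens-move (suc M) (λ n → proj₂ (proj₂ (pieces n))) _ _)
      where
      src tgt : ℕ → State
      src n = proj₁ (letterᵖ (advance n m))
      tgt n = proj₁ (proj₂ (letterᵖ (advance n m)))
      pieces : ∀ n → Path A (x n m) [] (src n) × Δ (src n) (just (word n m)) (tgt n)
                   × Path A (tgt n) [] (x n (suc m))
      pieces n = proj₂ (proj₂ (letterᵖ (advance n m)))

    travel : ∀ m L → m + L ≤ suc M → Path A′ (at m) (window w m L) (at (m + L))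
    travel m zero    _ rewrite +-identityʳ m = []
    travel m (suc L) bounded rewrite +-suc m L =
      advance-at m (s≤s⁻¹ (≤-trans (s≤s (m≤m+n m L)) bounded)) ++ᵖ travel (suc m) L bounded

-- The accepting lasso of the automaton with widgets

module Assembly {k ℓ : ℕ} (i : Fin (suc k)) (A : Automaton (Letter (suc k + ℓ))) (fin : IsFinite A)
                (C : Construction.Choice {k} {ℓ} i A fin)
                {w : ω-Word (Letter (k + ℓ))} (ep : EventuallyPeriodic w)
                (word : ℕ → ω-Word (Letter (suc k + ℓ)))
                (proj≡ : ∀ n m → Π≢ ℓ i (word n m) ≡ w m)
                (marked : ∀ m → component ℓ i (word m m) ≡ true)
                (only : ∀ m n → component ℓ i (word n m) ≡ true → n ≡ m)
                (τ : ∀ n → Trajectory A (word n)) where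
  open Automaton A
  open IsFinite fin
  open Construction {k} {ℓ} i A fin
  open Choice C
  open Tokens {k} {ℓ} i A fin
  open EventuallyPeriodic ep renaming (period to d)

  private
    B : Automaton (Letter (k + ℓ))
    B = project (Π≢ ℓ i) A

    𝒜″ : Automaton (Letter (k + ℓ))
    𝒜″ = A″ C

    x : ℕ → ℕ → State
    x n = Trajectory.state (τ n)

    projected : ∀ n m → Path B (x n m) (w m ∷ []) (x n (suc m))
    projected n m = subst (λ b → Path B (x n m) (b ∷ []) (x n (suc m))) (proj≡ n m)
                          (projectᵖ (Trajectory.advance (τ n) m))

  open Pumping B index ep using (bound; pump)
  -- The checkpoints are visits of `F` by token 0 alone: one accepting state in the occupied set is
  -- enough for a widget.
  open Enumeration (Trajectory.recurs (τ 0)) threshold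

  -- Divisible by the period and by the lengths of all accepting loops that
  -- shortening may leave.
  D : ℕ
  D = suc bound ! * d

  instance
    D≢0 : NonZero D
    D≢0 = m*n≢0 (suc bound !) d {{suc bound !≢0}}

  -- Counts the pairs of a position modulo `D` and an occupied set. It does not depend on the number
  -- of tokens, so `M` can be chosen from it without circularity.
  checkpoints : ℕ
  checkpoints = D * 2 ^ size

  M : ℕ
  M = enum checkpoints

  open Travel word proj≡ marked only x (λ n → Trajectory.advance (τ n)) M

  -- `suc bound` is a factor of its factorial, hence divides `D` and every multiple of `D`.
  bound≤ : ∀ {L} → 0 < L → D ∣ L → bound ≤ L
  bound≤ 0<L D∣L = ≤-trans (n≤1+n bound)
    (∣⇒≤ {{>-nonZero 0<L}} (∣-trans (∣-trans (m∣m*n (bound !)) (m∣m*n d)) D∣L))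

  ∣-length : ∀ {L} → D ∣ L → ∀ {b} → 0 < b → b ≤ bound → b ∣ L
  ∣-length D∣L 0<b b≤bound =
    ∣-trans (∣-trans (n∣n! 0<b) (∣-trans (m≤n⇒m!∣n! (m≤n⇒m≤1+n b≤bound)) (m∣m*n d))) D∣L

  module Loop {m L : ℕ} (t≤m : threshold ≤ m) (m+L≤M : m + L ≤ M) (0<L : 0 < L) (D∣L : D ∣ L)
              (Fm : F (x 0 m)) (same : value (at m) ≡ value (at (m + L))) where

    d∣L : d ∣ L
    d∣L = ∣-trans (n∣m*n (suc bound !)) D∣L

    u : List (Letter (k + ℓ))
    u = window w m L

    u≢[] : u ≢ []
    u≢[] = nonempty 0<L
      where
      nonempty : ∀ {n} → 0 < n → window w m n ≢ []
      nonempty {suc _} _ ()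

    at-F : Q′F
    at-F = at m , [ (x 0 m , ∈-tokens⁺ (suc M) z<s , Fm) ]

    -- Run `n` visits `F` infinitely often, so `pump` yields a segment and an accepting loop on the
    -- same word `u`; lifting them gives paths of `A`.
    u∈U : ∀ n → U (x n m) u
    u∈U n with f , Ff , r , a , b , refl , to-r , r-to-f , f-to-r
                 ← pump (projected n) (Trajectory.recurs (τ n)) t≤m d∣L (bound≤ 0<L D∣L) (∣-length D∣L)
      with v₁ , π₁ , eq₁ ← liftᵖ to-r
      with v₂ , π₂ , eq₂ ← liftᵖ r-to-f
      with v₃ , π₃ , eq₃ ← liftᵖ f-to-r =
        r , proj₂ (Aseg-L (x n m) r) (v₁ , π₁ , eq₁)
      , proj₂ (Aloop-L r)
          ( u≢[] , v₂ ++ v₃ , π₂ ++ᵖ π₃ , visits-junction π₂ π₃ Ff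
          , trans (map-++ (Π≢ ℓ i) v₂ v₃)
                  (trans (cong₂ _++_ eq₂ eq₃) (sym (window-+ w m a b))))

    u∈U′ : U′ (at m) u
    u∈U′ = subst (Path A′ (at m) u) (value-injective (sym same))
             (travel m L (≤-trans m+L≤M (n≤1+n M)))
         -- A state of the occupied set is the state of some token, and `u∈U` applies to the run of
         -- that token.
         , λ q q∈ → let n , _ , eq = ∈-tokens⁻ (suc M) q∈ in subst (λ p → U p u) eq (u∈U n)

    loop-at : ∀ {z} → Lfin (AU′ at-F) z → Σ[ π ∈ Path⁺ 𝒜″ (wid at-F nothing) (wid at-F nothing) ] Path⁺.word⁺ π ≡ z
    loop-at (q , r , q₀ , rF , π) =
      (in-widget (start q₀) ∷ᵖ (mapᵖ (λ p → wid at-F (just p)) (in-widget ∘ inner) π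
                                 ++ᵖ ε∷ (in-widget (loop rF)) []))
      , ++-identityʳ _

    start-tokens : Q′
    start-tokens = tokens (suc M) (λ n → Trajectory.origin (τ n)) , [ ∪⟨⟩-nonempty _ _ ]

    prefix : Path A′ start-tokens (window w 0 m) (at m)
    prefix = tokens-move (suc M) (λ n → Trajectory.launch (τ n)) _ _
             ++ᵖ travel 0 m (≤-trans (m≤m+n m L) (≤-trans m+L≤M (n≤1+n M)))

    prefix″ : Path 𝒜″ (base start-tokens) (window w 0 m) (wid at-F nothing)
    prefix″ = subst (λ v → Path 𝒜″ (base start-tokens) v (wid at-F nothing)) (++-identityʳ (window w 0 m))
                    (mapᵖ base in-A′ prefix ++ᵖ ε∷ enter [])

    z : ω-Word (Letter (k + ℓ))
    z j = w (j + m)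

    z-loop : z ≗ u ++ω z
    z-loop = window-++ω w m L λ j →
      periodic-% (≤-trans t≤m (≤-trans (m≤n+m m L) (m≤n+m (L + m) j))) (≤-trans t≤m (m≤n+m m j))
        (trans (cong (_% d) (trans (cong (j +_) (+-comm L m)) (sym (+-assoc j m L)))) (+-∣-% d (j + m) d∣L))

    w-prefix : w ≗ window w 0 m ++ω z
    w-prefix j = trans (cong w (sym (+-identityʳ j)))
      (window-++ω w 0 m (λ j → cong (λ n → w (j + n)) (+-identityʳ m)) j)

    start-initial : ∀ q → q ∈ value start-tokens → Q₀ q
    start-initial q q∈ with n , _ , refl ← ∈-tokens⁻ (suc M) q∈ = Trajectory.initial (τ n)

    accepted : Lω 𝒜″ w
    accepted with π , word≡ ← loop-at (proj₂ (AU′-L at-F) u∈U′) =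
      lasso , initial start-initial , (_ , repeat , lasso-recurs) , lasso-reads
      where
      open Lasso 𝒜″ π (subst (λ v → z ≗ v ++ω z) (sym word≡) z-loop)
                     (subst (_≢ []) (sym word≡) u≢[]) prefix″ w-prefix

  ∈L″ : Lω 𝒜″ w
  ∈L″
    with i , j , i<j , key≡ ← pigeonhole (n<1+n checkpoints)
           (λ c → combine (enum (toℕ c) mod D) (code (value (at (enum (toℕ c))))))
    with pos≡ , code≡ ← combine-injective (enum (toℕ i) mod D) _ (enum (toℕ j) mod D) _ key≡
    with L , eq ← m≤n⇒∃[o]m+o≡n (<⇒≤ (enum-mono i<j)) =
    Loop.accepted {m = enum (toℕ i)} {L = L}
      (start≤enum (toℕ i))
      -- The indices run from 0 to `checkpoints`, and `M` is the checkpoint with the last index, so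
      -- the whole loop is within reach of `travel`.
      (subst (_≤ M) (sym eq) (enum-mono-≤ (s≤s⁻¹ (toℕ<n j))))
      (+-cancelˡ-< (enum (toℕ i)) 0 L (subst₂ _<_ (sym (+-identityʳ _)) (sym eq) (enum-mono i<j)))
      (≡%⇒∣+ D (enum (toℕ i)) L
        (trans (mod-injective D (enum (toℕ i)) (enum (toℕ j)) pos≡) (cong (λ n → _%_ n D {{D≢0}}) (sym eq))))
      (enum-P (toℕ i))
      (trans (code-injective code≡) (cong (λ m → value (at m)) (sym eq)))
    where
    enum-mono-≤ : ∀ {j l} → j ≤ l → enum j ≤ enum l
    enum-mono-≤ j≤l with m≤n⇒m<n∨m≡n j≤l
    ... | inj₁ j<l  = <⇒≤ (enum-mono j<l)
    ... | inj₂ refl = ≤-refl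

-- Marks in encodings, and the conclusion

component-e : ∀ {k ℓ} (i : Fin (suc k)) (I : Interpretation (suc k) ℓ) m →
              component ℓ i (e I m) ≡ (lookup (Interpretation.fo I) i ≡ᵇ m)
component-e {ℓ = ℓ} i I m = trans (Vec.lookup-++ˡ (Vec.map (_≡ᵇ m) (Interpretation.fo I)) _ i)
                        (Vec.lookup-map i (_≡ᵇ m) (Interpretation.fo I))

-- An encoding marks a first-order variable only at its value, so any two marked positions equal
-- that value.
marks-unique : ∀ {𝔐 k ℓ} (i : Fin (suc k)) {φ : Formula 𝔐 (suc k) ℓ} {w} → L⟦ φ ⟧ w →
               ∀ m n → component ℓ i (w m) ≡ true → component ℓ i (w n) ≡ true → m ≡ n
marks-unique {ℓ = ℓ} i {w = w} (I , w≗ , _) m n m-marked n-marked = trans (sym (value≡ m m-marked)) (value≡ n n-marked)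
  where
  value≡ : ∀ l → component ℓ i (w l) ≡ true → lookup (Interpretation.fo I) i ≡ l
  value≡ l eq = ≡ᵇ⇒≡ _ l (subst T (trans (sym eq) (trans (cong (component ℓ i) (w≗ l)) (component-e i I l))) _)

theorem2 : ∀ (𝔐 : Structure) (k ℓ : ℕ) (i : Fin (suc k)) (φ : Formula 𝔐 (suc k) ℓ)
    (A : Automaton (Letter (suc k + ℓ))) (fin : IsFinite A) →
    Lω A ≐ L⟦ φ ⟧ →
    (C : Construction.Choice {k} {ℓ} i A fin) →
    (w″ : ω-Word (Letter (k + ℓ))) → UltimatelyPeriodic w″ →
    (∀ (n : ℕ) → Σ[ ρ ∈ TransitionSequence A ]
    StartsInitial A ρ × Büchi A ρ ×
    (∃[ w ] Reads A ρ w × Π≢ ℓ i ∘ w ≗ w″) ×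
    (∃[ a ] NthLetter A ρ n a × component ℓ i a ≡ true)) →
    Lω (Construction.A″ i A fin C) w″
theorem2 𝔐 k ℓ i φ A fin L≐ C w″ up runs =
  Assembly.∈L″ i A fin C (eventuallyPeriodic up) word proj≡ marked
    (λ m n eq → marks-unique i {φ} (model n) n m (marked n) eq)
    (λ n → let ρ , starts , büchi , (w , reads , _) , _ = runs n in trajectory A fin ρ starts büchi reads)
  where
  word : ℕ → ω-Word (Letter (suc k + ℓ))
  word n = let _ , _ , _ , (w , _) , _ = runs n in w

  proj≡ : ∀ n m → Π≢ ℓ i (word n m) ≡ w″ m
  proj≡ n m = let _ , _ , _ , (_ , _ , eq) , _ = runs n in eq m

  marked : ∀ m → component ℓ i (word m m) ≡ true
  marked m = let ρ , _ , _ , (_ , reads , _) , (a , nth , eq) = runs m in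
    -- The hypothesis marks a transition label; as both are the letter with index `m` of the same
    -- run, it agrees with the letter of the word read.
    trans (cong (component ℓ i) (NthLetter-unique ρ (reads m) nth)) eq

  model : ∀ n → L⟦ φ ⟧ (word n)
  model n = let ρ , starts , büchi , (_ , reads , _) , _ = runs n in
    proj₁ L≐ (ρ , starts , büchi , reads)
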